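{- Given any permutation $\pi$ of $\{1,\ldots,n\}$, there exists a sequence of at most $\frac{n^2}{4}$ cyclically adjacent transpositions that sorts $\pi$.
   Context: Let $\pi$ be a permutation of $\{1,\ldots,n\}$; $\pi(i)$ is called the position of element $i$, and $\pi^{ -1}(p)$ is the element in position $p$. For positions $p,q\in\{1,\ldots,n\}$, applying the transposition $(p,q)$ to $\pi$ swaps the elements in positions $p$ and $q$, giving the permutation $\tilde\pi$ with $\tilde\pi^{ -1}(p)=\pi^{ -1}(q)$, $\tilde\pi^{ -1}(q)=\pi^{ -1}(p)$ and $\tilde\pi^{ -1}(r)=\pi^{ -1}(r)$ for all $r\in\{1,\ldots,n\}\setminus\{p,q\}$. A transposition $(p,q)$ is cyclically adjacent if either $q=p+1$, or $p=n$ and $q=1$. A sequence of transpositions sorts $\pi$ if applying its members in order, starting from $\pi$, yields the identity permutation. -}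

module Defs where

open import Data.Fin.Base using (Fin; toℕ)
open import Data.Fin.Properties using (_≟_)
open import Data.Fin.Permutation using (Permutation′; _⟨$⟩ˡ_; _∘ₚ_; _≈_; id; transpose)
open import Data.Fin.Permutation.Transposition.List using (TranspositionList)
open import Data.List.Base using (foldl)
open import Data.Nat.Base using (ℕ; suc)
open import Data.Product.Base using (_×_; _,_)
open import Data.Sum.Base using (_⊎_)
open import Relation.Binary.PropositionalEquality using (_≡_; _≢_; refl)
open import Relation.Nullary using (yes; no; contradiction)

private
  variable
    n : ℕ

-- Elements and positions {1,…,n} are both represented by Fin n, shifted to
-- start at 0.  π ⟨$⟩ʳ i is the position of element i, and π ⟨$⟩ˡ p is the
-- element in position p.

-- Since _∘ₚ_ composes in diagrammatic order, the transposition acts on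
-- positions; the lemmas below confirm this.
applyTransposition : Permutation′ n → Fin n × Fin n → Permutation′ n
applyTransposition π (p , q) = π ∘ₚ transpose p q

applyTransposition-first : (π : Permutation′ n) (p q : Fin n) →
  applyTransposition π (p , q) ⟨$⟩ˡ p ≡ π ⟨$⟩ˡ q
applyTransposition-first π p q with p ≟ q
... | yes refl = refl
... | no _ with p ≟ p
...   | yes _  = refl
...   | no p≢p = contradiction refl p≢p

applyTransposition-second : (π : Permutation′ n) (p q : Fin n) →
  applyTransposition π (p , q) ⟨$⟩ˡ q ≡ π ⟨$⟩ˡ p
applyTransposition-second π p q with q ≟ q
... | yes _  = refl
... | no q≢q = contradiction refl q≢q

applyTransposition-other : (π : Permutation′ n) (p q r : Fin n) → r ≢ p → r ≢ q →
  applyTransposition π (p , q) ⟨$⟩ˡ r ≡ π ⟨$⟩ˡ r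
applyTransposition-other π p q r r≢p r≢q with r ≟ q
... | yes r≡q = contradiction r≡q r≢q
... | no _ with r ≟ p
...   | yes r≡p = contradiction r≡p r≢p
...   | no _    = refl

-- With positions starting at 0, the wrap-around pair (n , 1) becomes
-- (n - 1 , 0).
CyclicallyAdjacent : Fin n × Fin n → Set
CyclicallyAdjacent {n} (p , q) =
  toℕ q ≡ suc (toℕ p) ⊎ (suc (toℕ p) ≡ n × toℕ q ≡ 0)

Sorts : TranspositionList n → Permutation′ n → Set
Sorts ts π = foldl applyTransposition π ts ≈ id

{-# OPTIONS --safe #-}
module Submission where

-- Unroll the circle of positions onto ℤ: element i gets a lifted position
-- P i = π i + n (q i) with ∑ q = 0, and the displacement d i = i − P i.  A pair
-- of lifts has to cross a number of times determined by P on its way to the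
-- identity.  Swapping cyclic neighbours i, j with d j < d i saves one crossing;
-- once there are none left, d is constant around the circle, hence 0.  So the
-- total number of crossings is enough swaps.
--
-- For the bound, choose q such that all d i lie in [θ − n , θ]; then no pair
-- crosses twice.  Let S consist of the m elements of smallest displacement.  An
-- element of S never overtakes one outside S.  Comparing P b − P a
-- and b − a with P b + θ − a, which Hermite's identity lets us sum over a or b,
-- bounds the number of crossings by m² + (n − 2m) θ.  This is at most n²/4 if m
-- is n/2, rounded suitably.

open import Defs
open import Data.Bool.Base using (Bool; true; false; _∨_)
open import Data.Fin.Base as Fin using (Fin; toℕ; inject₁; fromℕ)
open import Data.Fin.Induction using (<-weakInduction; >-weakInduction)
open import Data.Fin.Permutation using (Permutation′; _⟨$⟩ʳ_; _⟨$⟩ˡ_; inverseˡ; inverseʳ; flip)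
import Data.Fin.Permutation.Components as PC
open import Data.Fin.Permutation.Transposition.List using (TranspositionList)
open import Data.Fin.Properties using (_≟_; toℕ<n; toℕ-injective; any?; toℕ-inject₁; toℕ-fromℕ)
open import Data.Integer.Base as ℤ using (ℤ; +_; ∣_∣)
open import Data.Integer.DivMod using ([n/ℕd]*d≤n; n<s[n/ℕd]*d)
open import Data.Integer.Properties as ℤ using (+-0-commutativeMonoid)
open import Data.Integer.Tactic.RingSolver using (solve-∀)
open import Data.List.Base using (length; []; _∷_)
open import Data.List.Relation.Unary.All using (All; []; _∷_)
open import Data.Nat.Base as ℕ using (ℕ)
import Data.Nat.Properties as ℕ
open import Data.Product.Base using (Σ-syntax; _×_; ∃-syntax; _,_; proj₁; proj₂)
open import Data.Sum.Base using (_⊎_; inj₁; inj₂; [_,_]′)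
open import Function.Base using (_∘_; id)
open import Relation.Binary.PropositionalEquality
open import Relation.Nullary using (contradiction; does; yes; no)
open import Relation.Nullary.Decidable using (dec-true; dec-false)

-- Integer inequalities and finite sums.

module _ where
  open import Algebra.Properties.CommutativeMonoid.Sum +-0-commutativeMonoid
    using (sum-syntax; ∑-distrib-+; ∑-comm; ∑-permute; sum-cong-≗; sum-replicate-zero)
  open import Data.Integer.Base
  open import Data.Integer.Properties hiding (_≟_)

  -- Linear inequalities are derived from a known inequality with the same slack; the equality of
  -- slacks is then a ring identity for `solve-∀`.
  ≤-by-difference : ∀ {a b c d} → c ≤ d → d - c ≡ b - a → a ≤ b
  ≤-by-difference c≤d eq = 0≤i-j⇒j≤i (subst (0ℤ ≤_) eq (i≤j⇒0≤j-i c≤d))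

  <⇒1+≤ : ∀ {a b} → a < b → a + + 1 ≤ b
  <⇒1+≤ {a} a<b = subst (_≤ _) (+-comm (+ 1) a) (i<j⇒suc[i]≤j a<b)

  1+≤⇒< : ∀ {a b} → a + + 1 ≤ b → a < b
  1+≤⇒< {a} h = suc[i]≤j⇒i<j (subst (_≤ _) (+-comm a (+ 1)) h)

  0≤1 : 0ℤ ≤ + 1
  0≤1 = +≤+ ℕ.z≤n

  ∑-mono-≤ : ∀ {n} {f g : Fin n → ℤ} → (∀ i → f i ≤ g i) → ∑[ i < n ] f i ≤ ∑[ i < n ] g i
  ∑-mono-≤ {ℕ.zero}  f≤g = ≤-refl
  ∑-mono-≤ {ℕ.suc _} f≤g = +-mono-≤ (f≤g Fin.zero) (∑-mono-≤ (f≤g ∘ Fin.suc))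

  ∑-distrib-* : ∀ {n} c (f : Fin n → ℤ) → ∑[ i < n ] (c * f i) ≡ c * ∑[ i < n ] f i
  ∑-distrib-* {ℕ.zero}  c f = sym (*-zeroʳ c)
  ∑-distrib-* {ℕ.suc n} c f =
    trans (cong (_+_ (c * f Fin.zero)) (∑-distrib-* c (f ∘ Fin.suc))) (sym (*-distribˡ-+ c (f Fin.zero) (∑[ i < n ] f (Fin.suc i))))

  ∑-distrib-- : ∀ {n} (f g : Fin n → ℤ) → ∑[ i < n ] (f i - g i) ≡ ∑[ i < n ] f i - ∑[ i < n ] g i
  ∑-distrib-- {ℕ.zero}  f g = refl
  ∑-distrib-- {ℕ.suc n} f g =
    trans (cong (_+_ (f Fin.zero - g Fin.zero)) (∑-distrib-- (f ∘ Fin.suc) (g ∘ Fin.suc))) (rearrange (f Fin.zero) (g Fin.zero) (∑[ i < n ] f (Fin.suc i)) (∑[ i < n ] g (Fin.suc i)))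
    where
    rearrange : ∀ a b c d → a - b + (c - d) ≡ a + c - (b + d)
    rearrange = solve-∀

  ∑-const : ∀ {n} c → ∑[ i < n ] c ≡ + n * c
  ∑-const {ℕ.zero}  c = refl
  ∑-const {ℕ.suc n} c = trans (cong (_+_ c) (∑-const {n} c)) (sym (suc-* (+ n) c))

  ∑-telescope : ∀ n (g : ℕ → ℤ) →
    ∑[ i < n ] g (ℕ.suc (toℕ i)) ≡ ∑[ i < n ] g (toℕ i) + (g n - g 0)
  ∑-telescope ℕ.zero    g = sym (cancel (g 0))
    where
    cancel : ∀ a → + 0 + (a - a) ≡ + 0
    cancel = solve-∀
  ∑-telescope (ℕ.suc n) g =
    trans (cong (_+_ (g 1)) (∑-telescope n (g ∘ ℕ.suc))) (rearrange (g 0) (g 1) (∑[ i < n ] g (ℕ.suc (toℕ i))) (g (ℕ.suc n)))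
    where
    rearrange : ∀ a b s c → b + (s + (c - b)) ≡ a + s + (c - a)
    rearrange = solve-∀

  -- Induction from 0 in both directions. The sums in Hermite's identity are functions of this kind.
  unit-steps⇒translation : (f : ℤ → ℤ) → (∀ x → f (x + + 1) ≡ f x + + 1) → ∀ x → f x ≡ x + f 0ℤ
  unit-steps⇒translation f step (+ ℕ.zero) = sym (+-identityˡ _)
  unit-steps⇒translation f step (+ ℕ.suc k) =
    trans (cong f (+-comm (+ 1) (+ k)))
    (trans (step (+ k))
    (trans (cong (_+ + 1) (unit-steps⇒translation f step (+ k))) (rearrange (+ k) (f 0ℤ))))
    where
    rearrange : ∀ a b → a + b + + 1 ≡ + 1 + a + b
    rearrange = solve-∀
  unit-steps⇒translation f step (-[1+ k ]) =
    trans (isolate _ _ (sym (step -[1+ k ]))) (trans (cong (_- + 1) (above k)) (rearrange (+ k) (f 0ℤ)))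
    where
    isolate : ∀ a b → a + + 1 ≡ b → a ≡ b - + 1
    isolate a _ refl = lemma a
      where
      lemma : ∀ a → a ≡ a + + 1 - + 1
      lemma = solve-∀
    -- `-[1+ k ] + + 1` only computes once it is known whether `k` is zero.
    above : ∀ k → f (-[1+ k ] + + 1) ≡ - + k + f 0ℤ
    above ℕ.zero    = sym (+-identityˡ _)
    above (ℕ.suc k) = unit-steps⇒translation f step -[1+ k ]
    rearrange : ∀ k b → - k + b - + 1 ≡ - (+ 1 + k) + b
    rearrange = solve-∀

  -- Indicators and the selection of smallest elements.

  𝟙 : Bool → ℤ
  𝟙 true  = + 1
  𝟙 false = + 0

  δ : ∀ {n} → Fin n → Fin n → ℤ
  δ x y = 𝟙 (does (y ≟ x))

  ∑-δ : ∀ {n} (x : Fin n) → ∑[ y < n ] δ x y ≡ + 1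
  ∑-δ {ℕ.suc n} Fin.zero    = cong (_+_ (+ 1)) (sum-replicate-zero n)
  ∑-δ {ℕ.suc n} (Fin.suc x) = trans (+-identityˡ _) (∑-δ x)

  count : ∀ {n} (s : Fin n → Bool) → ∃[ m ] m ℕ.≤ n × ∑[ i < n ] 𝟙 (s i) ≡ + m
  count {ℕ.zero}  s = 0 , ℕ.z≤n , refl
  count {ℕ.suc n} s with s Fin.zero | count (s ∘ Fin.suc)
  ... | true  | m , m≤n , eq = ℕ.suc m , ℕ.s≤s m≤n , cong (_+_ (+ 1)) eq
  ... | false | m , m≤n , eq = m , ℕ.m≤n⇒m≤1+n m≤n , trans (+-identityˡ _) eq

  -- Serves as the search step of a selection sort and, with nothing selected, finds an overall
  -- minimum.
  minimum-unselected : ∀ {n} (f : Fin n → ℤ) (s : Fin n → Bool) →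
    (∀ i → s i ≡ true) ⊎ (∃[ x ] s x ≡ false × ∀ y → s y ≡ false → f x ≤ f y)
  minimum-unselected {ℕ.zero}  f s = inj₁ λ ()
  minimum-unselected {ℕ.suc n} f s
    with s Fin.zero in s0 | minimum-unselected (f ∘ Fin.suc) (s ∘ Fin.suc)
  ... | true | inj₁ all = inj₁ λ { Fin.zero → s0 ; (Fin.suc i) → all i }
  ... | true | inj₂ (x , sx , min) = inj₂ (Fin.suc x , sx , λ
    { Fin.zero sy → contradiction (trans (sym s0) sy) λ ()
    ; (Fin.suc y) sy → min y sy })
  ... | false | inj₁ all = inj₂ (Fin.zero , s0 , λ
    { Fin.zero sy → ≤-refl
    ; (Fin.suc y) sy → contradiction (trans (sym (all y)) sy) λ () })
  ... | false | inj₂ (x , sx , min) with ≤-total (f Fin.zero) (f (Fin.suc x))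
  ...   | inj₁ f0≤fx = inj₂ (Fin.zero , s0 , λ
    { Fin.zero sy → ≤-refl
    ; (Fin.suc y) sy → ≤-trans f0≤fx (min y sy) })
  ...   | inj₂ fx≤f0 = inj₂ (Fin.suc x , sx , λ
    { Fin.zero sy → fx≤f0
    ; (Fin.suc y) sy → min y sy })

  -- Greedy choice: a minimal unselected `x` lies below everything still unselected, and the
  -- elements chosen earlier already did.
  select-smallest : ∀ {n} (f : Fin n → ℤ) m → m ℕ.≤ n →
    Σ[ s ∈ (Fin n → Bool) ] ∑[ i < n ] 𝟙 (s i) ≡ + m ×
      (∀ a b → s a ≡ true → s b ≡ false → f a ≤ f b)
  select-smallest {n} f ℕ.zero    _   = (λ _ → false) , sum-replicate-zero n , λ _ _ ()
  select-smallest {n} f (ℕ.suc m) m<n with select-smallest f m (ℕ.<⇒≤ m<n)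
  ... | s , ∑s≡m , s-smallest with minimum-unselected f s
  ...   | inj₁ all = contradiction (+-injective (trans (sym ∑s≡m) ∑s≡n)) (ℕ.<⇒≢ m<n)
    where
    ∑s≡n : ∑[ i < n ] 𝟙 (s i) ≡ + n
    ∑s≡n = trans (sum-cong-≗ {n} (cong 𝟙 ∘ all)) (trans (∑-const {n} (+ 1)) (*-identityʳ (+ n)))
  ...   | inj₂ (x , sx , x-min) = s′ , ∑s′ , smallest
    where
    s′ : Fin n → Bool
    s′ i = s i ∨ does (i ≟ x)
    pointwise : ∀ i → 𝟙 (s′ i) ≡ 𝟙 (s i) + δ x i
    pointwise i with s i in si | i ≟ x
    ... | true  | yes refl = contradiction (trans (sym si) sx) λ ()
    ... | true  | no _     = refl
    ... | false | yes _    = refl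
    ... | false | no _     = refl
    ∑s′ : ∑[ i < n ] 𝟙 (s′ i) ≡ + ℕ.suc m
    ∑s′ = trans (sum-cong-≗ {n} pointwise) (trans (∑-distrib-+ {n} (𝟙 ∘ s) (δ x))
      (trans (cong₂ _+_ ∑s≡m (∑-δ x)) (cong +_ (ℕ.+-comm m 1))))
    smallest : ∀ a b → s′ a ≡ true → s′ b ≡ false → f a ≤ f b
    smallest a b s′a s′b with s a in sa | s b in sb | a ≟ x
    ... | true  | false | _        = s-smallest a b sa sb
    ... | false | false | yes refl = x-min b sb
    ... | _     | true  | _        = contradiction s′b λ ()
    ... | false | false | no _     = contradiction s′a λ ()

  -- Charging the crossings of a pair to its two orderings.

  ∣∣≤ : ∀ {x y} → x ≤ y → - x ≤ y → + ∣ x ∣ ≤ y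
  ∣∣≤ {+ _}      x≤y _ = x≤y
  ∣∣≤ { -[1+ _ ]} _ -x≤y = -x≤y

  -- The crossings of the pair (a , b) are paid for by the shares of (a , b) and
  -- (b , a).  The last argument w is within 1 above both x and y.  Inside S the
  -- share is 1 − (w − x), outside S it is w − y, from S to its complement it is
  -- y − x and back it is 0; the formula adds 2 (y − x) inside S, which cancels
  -- against (b , a), so that its terms can be summed over full rows and columns.
  share : Bool → Bool → ℤ → ℤ → ℤ → ℤ
  share s s′ x y w = 𝟙 s * (+ 1 - (w - x) - + 2 * (x - y)) + ((+ 1 - 𝟙 s′) * (w - y) - 𝟙 s * (+ 1 - 𝟙 s′))

  -- The equation for `x′` is the antisymmetry of `D`. It cancels the doubled terms when both
  -- elements are selected. With equal memberships the bounds on `w` and `w′` suffice; in the mixed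
  -- cases the sign of `x - y` is known and the shares add up to its absolute value.
  crossing≤shares : ∀ s s′ x y w x′ y′ w′ →
    x ≤ w → w ≤ x + + 1 → y ≤ w → w ≤ y + + 1 →
    x′ ≤ w′ → w′ ≤ x′ + + 1 → y′ ≤ w′ → w′ ≤ y′ + + 1 →
    x′ ≡ - (x - y) + y′ → (s ≡ true → s′ ≡ false → x ≤ y) → (s′ ≡ true → s ≡ false → x′ ≤ y′) →
    + ∣ x - y ∣ ≤ share s s′ x y w + share s′ s x′ y′ w′
  crossing≤shares true true x y w _ y′ w′ x≤w w≤x y≤w w≤y x′≤w′ w′≤x′ y′≤w′ w′≤y′ refl ss′ s′s =
    ∣∣≤ (≤-by-difference (+-mono-≤ w≤y w′≤x′) (eq₁ x y w y′ w′)) (≤-by-difference (+-mono-≤ w≤x w′≤y′) (eq₂ x y w y′ w′))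
    where
    eq₁ : ∀ x y w y′ w′ → y + + 1 + (- (x - y) + y′ + + 1) - (w + w′) ≡
      + 1 * (+ 1 - (w - x) - + 2 * (x - y)) + ((+ 1 - + 1) * (w - y) - + 1 * (+ 1 - + 1))
      + (+ 1 * (+ 1 - (w′ - (- (x - y) + y′)) - + 2 * ((- (x - y) + y′) - y′)) + ((+ 1 - + 1) * (w′ - y′) - + 1 * (+ 1 - + 1)))
      - (x - y)
    eq₁ = solve-∀
    eq₂ : ∀ x y w y′ w′ → x + + 1 + (y′ + + 1) - (w + w′) ≡
      + 1 * (+ 1 - (w - x) - + 2 * (x - y)) + ((+ 1 - + 1) * (w - y) - + 1 * (+ 1 - + 1))
      + (+ 1 * (+ 1 - (w′ - (- (x - y) + y′)) - + 2 * ((- (x - y) + y′) - y′)) + ((+ 1 - + 1) * (w′ - y′) - + 1 * (+ 1 - + 1)))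
      - - (x - y)
    eq₂ = solve-∀
  crossing≤shares false false x y w _ y′ w′ x≤w w≤x y≤w w≤y x′≤w′ w′≤x′ y′≤w′ w′≤y′ refl ss′ s′s =
    ∣∣≤ (≤-by-difference (+-mono-≤ x≤w y′≤w′) (eq₁ x y w y′ w′)) (≤-by-difference (+-mono-≤ y≤w x′≤w′) (eq₂ x y w y′ w′))
    where
    eq₁ : ∀ x y w y′ w′ → w + w′ - (x + y′) ≡
      + 0 * (+ 1 - (w - x) - + 2 * (x - y)) + ((+ 1 - + 0) * (w - y) - + 0 * (+ 1 - + 0))
      + (+ 0 * (+ 1 - (w′ - (- (x - y) + y′)) - + 2 * ((- (x - y) + y′) - y′)) + ((+ 1 - + 0) * (w′ - y′) - + 0 * (+ 1 - + 0)))
      - (x - y)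
    eq₁ = solve-∀
    eq₂ : ∀ x y w y′ w′ → w + w′ - (y + (- (x - y) + y′)) ≡
      + 0 * (+ 1 - (w - x) - + 2 * (x - y)) + ((+ 1 - + 0) * (w - y) - + 0 * (+ 1 - + 0))
      + (+ 0 * (+ 1 - (w′ - (- (x - y) + y′)) - + 2 * ((- (x - y) + y′) - y′)) + ((+ 1 - + 0) * (w′ - y′) - + 0 * (+ 1 - + 0)))
      - - (x - y)
    eq₂ = solve-∀
  crossing≤shares true false x y w _ y′ w′ x≤w w≤x y≤w w≤y x′≤w′ w′≤x′ y′≤w′ w′≤y′ refl ss′ s′s =
    ∣∣≤ (≤-by-difference (+-mono-≤ (ss′ refl refl) (ss′ refl refl)) (eq₁ x y w y′ w′))
        (≤-by-difference (≤-refl {x}) (eq₂ x y w y′ w′))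
    where
    eq₁ : ∀ x y w y′ w′ → y + y - (x + x) ≡
      + 1 * (+ 1 - (w - x) - + 2 * (x - y)) + ((+ 1 - + 0) * (w - y) - + 1 * (+ 1 - + 0))
      + (+ 0 * (+ 1 - (w′ - (- (x - y) + y′)) - + 2 * ((- (x - y) + y′) - y′)) + ((+ 1 - + 1) * (w′ - y′) - + 0 * (+ 1 - + 1)))
      - (x - y)
    eq₁ = solve-∀
    eq₂ : ∀ x y w y′ w′ → x - x ≡
      + 1 * (+ 1 - (w - x) - + 2 * (x - y)) + ((+ 1 - + 0) * (w - y) - + 1 * (+ 1 - + 0))
      + (+ 0 * (+ 1 - (w′ - (- (x - y) + y′)) - + 2 * ((- (x - y) + y′) - y′)) + ((+ 1 - + 1) * (w′ - y′) - + 0 * (+ 1 - + 1)))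
      - - (x - y)
    eq₂ = solve-∀
  crossing≤shares false true x y w _ y′ w′ x≤w w≤x y≤w w≤y x′≤w′ w′≤x′ y′≤w′ w′≤y′ refl ss′ s′s =
    ∣∣≤ (≤-by-difference (≤-refl {x}) (eq₁ x y w y′ w′))
        (≤-by-difference (+-mono-≤ (s′s refl refl) (s′s refl refl)) (eq₂ x y w y′ w′))
    where
    eq₁ : ∀ x y w y′ w′ → x - x ≡
      + 0 * (+ 1 - (w - x) - + 2 * (x - y)) + ((+ 1 - + 1) * (w - y) - + 0 * (+ 1 - + 1))
      + (+ 1 * (+ 1 - (w′ - (- (x - y) + y′)) - + 2 * ((- (x - y) + y′) - y′)) + ((+ 1 - + 0) * (w′ - y′) - + 1 * (+ 1 - + 0)))
      - (x - y)
    eq₁ = solve-∀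
    eq₂ : ∀ x y w y′ w′ → y′ + y′ - (- (x - y) + y′ + (- (x - y) + y′)) ≡
      + 0 * (+ 1 - (w - x) - + 2 * (x - y)) + ((+ 1 - + 1) * (w - y) - + 0 * (+ 1 - + 1))
      + (+ 1 * (+ 1 - (w′ - (- (x - y) + y′)) - + 2 * ((- (x - y) + y′) - y′)) + ((+ 1 - + 0) * (w′ - y′) - + 1 * (+ 1 - + 0)))
      - - (x - y)
    eq₂ = solve-∀

  -- Transpositions, and matrices that change at one symmetric pair.

  transpose-first : ∀ {n} (p q : Fin n) → PC.transpose p q p ≡ q
  transpose-first p q rewrite dec-true (p ≟ p) refl = refl

  transpose-second : ∀ {n} (p q : Fin n) → PC.transpose p q q ≡ p
  transpose-second p q with q ≟ p
  ... | yes q≡p = q≡p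
  ... | no  _ rewrite dec-true (q ≟ q) refl = refl

  transpose-other : ∀ {n} (p q r : Fin n) → r ≢ p → r ≢ q → PC.transpose p q r ≡ r
  transpose-other p q r r≢p r≢q rewrite dec-false (r ≟ p) r≢p | dec-false (r ≟ q) r≢q = refl

  δ-same : ∀ {n} (x : Fin n) → δ x x ≡ + 1
  δ-same x = cong 𝟙 (dec-true (x ≟ x) refl)

  δ-other : ∀ {n} {x y : Fin n} → y ≢ x → δ x y ≡ + 0
  δ-other {x = x} {y} y≢x = cong 𝟙 (dec-false (y ≟ x) y≢x)

  ∣-1∣ : ∀ x → + 1 ≤ x → + ∣ x - + 1 ∣ + + 1 ≡ + ∣ x ∣
  ∣-1∣ (+ ℕ.suc k) _ = cong +_ (ℕ.+-comm k 1)
  ∣-1∣ (+ ℕ.zero) (+≤+ ())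

  -- Collects the case distinction for a swap into one formula; the products of deltas make the
  -- change easy to sum.
  lower-symmetric-pair : ∀ {n} (M′ M : Fin n → Fin n → ℤ) {i j : Fin n} → i ≢ j →
    M′ i j + + 1 ≡ M i j → M′ j i + + 1 ≡ M j i → (∀ a → M′ a a ≡ M a a) →
    (∀ {b} → b ≢ i → b ≢ j → M′ i b ≡ M i b) → (∀ {b} → b ≢ i → b ≢ j → M′ j b ≡ M j b) →
    (∀ {a} → a ≢ i → a ≢ j → M′ a i ≡ M a i) → (∀ {a} → a ≢ i → a ≢ j → M′ a j ≡ M a j) →
    (∀ {a b} → a ≢ i → a ≢ j → b ≢ i → b ≢ j → M′ a b ≡ M a b) →
    ∀ a b → M′ a b + (δ i a * δ j b + δ j a * δ i b) ≡ M a b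
  lower-symmetric-pair M′ M {i} {j} i≢j ij ji diagonal row-i row-j column-i column-j other a b
    with a ≟ i | a ≟ j | b ≟ i | b ≟ j
  ... | yes refl | yes i≡j  | _        | _        = contradiction i≡j i≢j
  ... | _        | _        | yes refl | yes i≡j  = contradiction i≡j i≢j
  ... | yes refl | no _     | yes refl | no _     = trans (+-identityʳ _) (diagonal i)
  ... | yes refl | no _     | no _     | yes refl = ij
  ... | yes refl | no _     | no b≢i   | no b≢j   = trans (+-identityʳ _) (row-i b≢i b≢j)
  ... | no _     | yes refl | yes refl | no _     = ji
  ... | no _     | yes refl | no _     | yes refl = trans (+-identityʳ _) (diagonal j)
  ... | no _     | yes refl | no b≢i   | no b≢j   = trans (+-identityʳ _) (row-j b≢i b≢j)
  ... | no a≢i   | no a≢j   | yes refl | no _     = trans (+-identityʳ _) (column-i a≢i a≢j)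
  ... | no a≢i   | no a≢j   | no _     | yes refl = trans (+-identityʳ _) (column-j a≢i a≢j)
  ... | no a≢i   | no a≢j   | no b≢i   | no b≢j   = trans (+-identityʳ _) (other a≢i a≢j b≢i b≢j)

  -- The size of the selected set.

  half : ∀ k → ∃[ h ] (k ≡ h ℕ.+ h ⊎ k ≡ ℕ.suc (h ℕ.+ h))
  half ℕ.zero = 0 , inj₁ refl
  half (ℕ.suc k) with half k
  ... | h , inj₁ k≡2h   = h , inj₂ (cong ℕ.suc k≡2h)
  ... | h , inj₂ k≡2h+1 = ℕ.suc h , inj₁ (cong ℕ.suc (trans k≡2h+1 (sym (ℕ.+-suc h h))))

  -- For odd k, m is the neighbour of k / 2 with (k − 2m) (θ − m) ≤ 0.
  near-half : ∀ k θ → ∃[ m ] m ℕ.≤ k ×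
    + 4 * (+ m * + m + (+ k - + 2 * + m) * θ) ≤ + k * + k
  near-half k θ with half k
  ... | h , inj₁ refl = h , ℕ.m≤m+n h h , ≤-reflexive (eq (+ h) θ)
    where
    eq : ∀ h θ → + 4 * (h * h + (h + h - + 2 * h) * θ) ≡ (h + h) * (h + h)
    eq = solve-∀
  ... | h , inj₂ refl with θ ≤? + h
  ...   | yes θ≤h = h , ℕ.m≤n⇒m≤1+n (ℕ.m≤m+n h h) , ≤-by-difference
    (+-mono-≤ (*-monoˡ-≤-nonNeg (+ 4) θ≤h) 0≤1) (eq (+ h) θ)
    where
    eq : ∀ h θ → + 4 * h + + 1 - (+ 4 * θ + + 0) ≡
      (+ 1 + (h + h)) * (+ 1 + (h + h)) - + 4 * (h * h + (+ 1 + (h + h) - + 2 * h) * θ)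
    eq = solve-∀
  ...   | no  θ≰h = ℕ.suc h , ℕ.s≤s (ℕ.m≤m+n h h) , ≤-by-difference
    (+-mono-≤ (*-monoˡ-≤-nonNeg (+ 4) (<⇒1+≤ (≰⇒> θ≰h))) 0≤1) (eq (+ h) θ)
    where
    eq : ∀ h θ → + 4 * θ + + 1 - (+ 4 * (h + + 1) + + 0) ≡
      (+ 1 + (h + h)) * (+ 1 + (h + h)) - + 4 * ((+ 1 + h) * (+ 1 + h) + (+ 1 + (h + h) - + 2 * (+ 1 + h)) * θ)
    eq = solve-∀

  -- Floors of quotients by n, up to Hermite's identity.

  module Floor (n-1 : ℕ) where

    n : ℕ
    n = ℕ.suc n-1

    N : ℤ
    N = + n

    -- Opaque, so that the argument of a floor can be inferred.
    opaque
      ⌊_⌋ : ℤ → ℤ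
      ⌊ x ⌋ = x /ℕ n

      ⌊x⌋*N≤x : ∀ x → ⌊ x ⌋ * N ≤ x
      ⌊x⌋*N≤x x = [n/ℕd]*d≤n x n

      x<[⌊x⌋+1]*N : ∀ x → x < (⌊ x ⌋ + + 1) * N
      x<[⌊x⌋+1]*N x = subst (λ y → x < y * N) (+-comm (+ 1) (x /ℕ n)) (n<s[n/ℕd]*d x n)

    _∤ₙ : ℤ → Set
    x ∤ₙ = ∀ k → x ≢ k * N

    *N-cancel-< : ∀ a b → a * N < b * N → a < b
    *N-cancel-< a b = *-cancelʳ-<-nonNeg {a} {b} N

    ≤⌊⌋ : ∀ k x → k * N ≤ x → k ≤ ⌊ x ⌋
    ≤⌊⌋ k x h = ≤-by-difference (<⇒1+≤ (*N-cancel-< k (⌊ x ⌋ + + 1) (≤-<-trans h (x<[⌊x⌋+1]*N x)))) (eq k ⌊ x ⌋)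
      where
      eq : ∀ k f → f + + 1 - (k + + 1) ≡ f - k
      eq = solve-∀

    ⌊⌋< : ∀ k x → x < k * N → ⌊ x ⌋ < k
    ⌊⌋< k x h = *N-cancel-< ⌊ x ⌋ k (≤-<-trans (⌊x⌋*N≤x x) h)

    ⌊⌋-mono : ∀ {x y} → x ≤ y → ⌊ x ⌋ ≤ ⌊ y ⌋
    ⌊⌋-mono {x} {y} x≤y = ≤⌊⌋ ⌊ x ⌋ y (≤-trans (⌊x⌋*N≤x x) x≤y)

    ⌊⌋-shift : ∀ x k → ⌊ x + k * N ⌋ ≡ ⌊ x ⌋ + k
    ⌊⌋-shift x k = ≤-antisym
      (≤-by-difference
        (≤⌊⌋ (⌊ x + k * N ⌋ - k) x (≤-by-difference (⌊x⌋*N≤x (x + k * N)) (eq₁ ⌊ x + k * N ⌋ k x N)))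
        (eq₂ ⌊ x + k * N ⌋ k ⌊ x ⌋))
      (≤⌊⌋ (⌊ x ⌋ + k) (x + k * N) (≤-by-difference (⌊x⌋*N≤x x) (eq₃ ⌊ x ⌋ k x N)))
      where
      eq₁ : ∀ f k x N → x + k * N - f * N ≡ x - (f - k) * N
      eq₁ = solve-∀
      eq₂ : ∀ f k g → g - (f - k) ≡ g + k - f
      eq₂ = solve-∀
      eq₃ : ∀ f k x N → x - f * N ≡ x + k * N - (f + k) * N
      eq₃ = solve-∀

    -- The floor jumps only on reaching a multiple of n. This is why moving a lift by one does not
    -- affect its crossings with distant lifts.
    ⌊⌋-suc-∤ : ∀ x → (x + + 1) ∤ₙ → ⌊ x + + 1 ⌋ ≡ ⌊ x ⌋
    ⌊⌋-suc-∤ x x+1∤ = ≤-antisym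
      (≤⌊⌋ ⌊ x + + 1 ⌋ x (≤-by-difference (<⇒1+≤ (≤∧≢⇒< (⌊x⌋*N≤x (x + + 1)) (x+1∤ ⌊ x + + 1 ⌋ ∘ sym))) (eq (⌊ x + + 1 ⌋ * N) x)))
      (⌊⌋-mono (≤-by-difference {x} {x + + 1} 0≤1 (eq′ x)))
      where
      eq : ∀ f x → x + + 1 - (f + + 1) ≡ x - f
      eq = solve-∀
      eq′ : ∀ x → + 1 - + 0 ≡ x + + 1 - x
      eq′ = solve-∀

    ⌊⌋-suc-∣ : ∀ x k → x + + 1 ≡ k * N → ⌊ x ⌋ ≡ k - + 1
    ⌊⌋-suc-∣ x k x+1≡kN = ≤-antisym
      (≤-by-difference (<⇒1+≤ (⌊⌋< k x (1+≤⇒< {x} (≤-reflexive x+1≡kN)))) (eq₁ ⌊ x ⌋ k))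
      (≤⌊⌋ (k - + 1) x (≤-by-difference {(k - + 1) * N} {x} (+≤+ (ℕ.s≤s (ℕ.z≤n {n-1})))
        (trans (eq₂ k N) (trans (cong (λ y → y - + 1 - (k - + 1) * N) (sym x+1≡kN)) (eq₃ x k N)))))
      where
      eq₁ : ∀ f k → k - (f + + 1) ≡ k - + 1 - f
      eq₁ = solve-∀
      eq₂ : ∀ k N → N - + 1 ≡ k * N - + 1 - (k - + 1) * N
      eq₂ = solve-∀
      eq₃ : ∀ x k N → x + + 1 - + 1 - (k - + 1) * N ≡ x - (k - + 1) * N
      eq₃ = solve-∀

    -- The negative of `⌊ - x ⌋` is the ceiling of x / n, one more than the floor unless n divides
    -- x.
    ⌊⌋-neg : ∀ x → x ∤ₙ → ⌊ - x ⌋ ≡ - + 1 - ⌊ x ⌋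
    ⌊⌋-neg x x∤ = ≤-antisym
      (≤-by-difference (<⇒1+≤ (⌊⌋< (- ⌊ - x ⌋) x (≤∧≢⇒<
        (≤-by-difference (⌊x⌋*N≤x (- x)) (eq₁ ⌊ - x ⌋ x N)) (x∤ (- ⌊ - x ⌋))))) (eq₂ ⌊ - x ⌋ ⌊ x ⌋))
      (≤⌊⌋ (- + 1 - ⌊ x ⌋) (- x) (≤-by-difference (<⇒≤ (x<[⌊x⌋+1]*N x)) (eq₃ ⌊ x ⌋ x N)))
      where
      eq₁ : ∀ f x N → - x - f * N ≡ - f * N - x
      eq₁ = solve-∀
      eq₂ : ∀ f g → - f - (g + + 1) ≡ - + 1 - g - f
      eq₂ = solve-∀
      eq₃ : ∀ f x N → (f + + 1) * N - x ≡ - x - (- + 1 - f) * N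
      eq₃ = solve-∀

    ⌊toℕ⌋ : (c : Fin n) → ⌊ + toℕ c ⌋ ≡ 0ℤ
    ⌊toℕ⌋ c = ≤-antisym
      (≤-by-difference (<⇒1+≤ (⌊⌋< (+ 1) (+ toℕ c) (subst (+ toℕ c <_) (sym (*-identityˡ N)) (+<+ (toℕ<n c))))) (eq ⌊ + toℕ c ⌋))
      (≤⌊⌋ 0ℤ (+ toℕ c) (+≤+ ℕ.z≤n))
      where
      eq : ∀ f → + 1 - (f + + 1) ≡ + 0 - f
      eq = solve-∀

    ⌊multiple⌋ : ∀ k → ⌊ k * N ⌋ ≡ k
    ⌊multiple⌋ k = trans (cong ⌊_⌋ (sym (+-identityˡ (k * N))))
      (trans (⌊⌋-shift 0ℤ k) (trans (cong (_+ k) (⌊toℕ⌋ Fin.zero)) (+-identityˡ k)))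

    -- Both residues have floor 0, so taking floors on both sides forces `k` to be 0.
    residues-distinct : ∀ (a b : Fin n) k → + toℕ a ≡ + toℕ b + k * N → a ≡ b
    residues-distinct a b k eq = toℕ-injective (+-injective (trans eq
      (trans (cong (λ k → + toℕ b + k * N) k≡0) (+-identityʳ (+ toℕ b)))))
      where
      k≡0 : k ≡ 0ℤ
      k≡0 = trans (sym (+-identityˡ k)) (trans (cong (_+ k) (sym (⌊toℕ⌋ b)))
        (trans (sym (⌊⌋-shift (+ toℕ b) k)) (trans (cong ⌊_⌋ (sym eq)) (⌊toℕ⌋ a))))

    -- Hermite's identity in difference form, so that the constant `H 0ℤ` cancels. Raising `x` by
    -- one shifts the summation index, and the end terms `⌊ x + + n ⌋` and `⌊ x ⌋` differ by 1.
    Hermite-+ : ∀ x y → ∑[ b < n ] ⌊ x + + toℕ b ⌋ - ∑[ b < n ] ⌊ y + + toℕ b ⌋ ≡ x - y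
    Hermite-+ x y = trans (cong₂ _-_ (translation x) (translation y)) (eq x y (H 0ℤ))
      where
      H : ℤ → ℤ
      H x = ∑[ b < n ] ⌊ x + + toℕ b ⌋
      assoc′ : ∀ x c → x + + 1 + c ≡ x + (+ 1 + c)
      assoc′ = solve-∀
      step : ∀ x → H (x + + 1) ≡ H x + + 1
      step x = trans (sum-cong-≗ {n} (λ b → cong ⌊_⌋ (assoc′ x (+ toℕ b))))
        (trans (∑-telescope n (λ k → ⌊ x + + k ⌋)) (cong (_+_ (H x)) increment))
        where
        cancel : ∀ f → f + + 1 - f ≡ + 1
        cancel = solve-∀
        increment : ⌊ x + + n ⌋ - ⌊ x + + 0 ⌋ ≡ + 1
        increment = trans (cong₂ (λ u v → ⌊ x + u ⌋ - ⌊ v ⌋) (sym (*-identityˡ N)) (+-identityʳ x))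
          (trans (cong (_- ⌊ x ⌋) (⌊⌋-shift x (+ 1))) (cancel ⌊ x ⌋))
      translation = unit-steps⇒translation H step
      eq : ∀ x y h → x + h - (y + h) ≡ x - y
      eq = solve-∀

    -- The reflected version, for sums over the subtracted position; the index now shifts the other
    -- way.
    Hermite-- : ∀ x y → ∑[ b < n ] ⌊ x - + toℕ b ⌋ - ∑[ b < n ] ⌊ y - + toℕ b ⌋ ≡ x - y
    Hermite-- x y = trans (cong₂ _-_ (translation x) (translation y)) (eq x y (H 0ℤ))
      where
      H : ℤ → ℤ
      H x = ∑[ b < n ] ⌊ x - + toℕ b ⌋
      assoc′ : ∀ x c → x - c ≡ x + + 1 - (+ 1 + c)
      assoc′ = solve-∀
      step : ∀ x → H (x + + 1) ≡ H x + + 1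
      step x = sym (trans (cong (_+ + 1) (trans (sum-cong-≗ {n} (λ b → cong ⌊_⌋ (assoc′ x (+ toℕ b))))
        (∑-telescope n (λ k → ⌊ x + + 1 - + k ⌋))))
        (trans (cong (λ u → H (x + + 1) + u + + 1) decrement) (cancel′ (H (x + + 1)))))
        where
        cancel : ∀ f → f + - + 1 - f ≡ - + 1
        cancel = solve-∀
        cancel′ : ∀ f → f + - + 1 + + 1 ≡ f
        cancel′ = solve-∀
        minus-N : ∀ x N → x - N ≡ x + - + 1 * N
        minus-N = solve-∀
        decrement : ⌊ x + + 1 - + n ⌋ - ⌊ x + + 1 - + 0 ⌋ ≡ - + 1
        decrement = trans (cong₂ (λ u v → ⌊ u ⌋ - ⌊ v ⌋) (minus-N (x + + 1) N) (+-identityʳ (x + + 1)))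
          (trans (cong (_- ⌊ x + + 1 ⌋) (⌊⌋-shift (x + + 1) (- + 1))) (cancel ⌊ x + + 1 ⌋))
      translation = unit-steps⇒translation H step
      eq : ∀ x y h → x + h - (y + h) ≡ x - y
      eq = solve-∀

  -- Lifted positions, displacements and crossings.

  module Sorting (n-1 : ℕ) where
    open Floor n-1

    module Lift (π : Permutation′ n) (q : Fin n → ℤ) where

      -- ∣ D a b ∣ is the number of times that lifts of a and b have to cross.  Each
      -- pair is counted twice in Φ.
      P T d : Fin n → ℤ
      P i = + toℕ (π ⟨$⟩ʳ i) + q i * N
      T i = + toℕ i
      d i = T i - P i

      -- The lift of `b` moved back by k n is at or beyond the lift of `a` exactly when k ≤ `X a b`
      -- at the start, and k ≤ `Y a b` at the end.
      X Y D : Fin n → Fin n → ℤ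
      X a b = ⌊ P b - P a ⌋
      Y a b = ⌊ T b - T a ⌋
      D a b = X a b - Y a b

      Φ : ℤ
      Φ = ∑[ a < n ] ∑[ b < n ] (+ ∣ D a b ∣)

      -- Modulo n a lift is its position, and `π` is injective.
      P-distinct : ∀ {a b} → a ≢ b → (P b - P a) ∤ₙ
      P-distinct {a} {b} a≢b k eq = a≢b (trans (sym (inverseˡ π))
        (trans (cong (π ⟨$⟩ˡ_) (sym (residues-distinct (π ⟨$⟩ʳ b) (π ⟨$⟩ʳ a) (k - q b + q a) residue))) (inverseˡ π)))
        where
        expand : ∀ p p′ q q′ N → p′ ≡ (p′ + q′ * N) - (p + q * N) + (p + (q - q′) * N)
        expand = solve-∀
        collect : ∀ p q q′ k N → k * N + (p + (q - q′) * N) ≡ p + (k - q′ + q) * N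
        collect = solve-∀
        residue : + toℕ (π ⟨$⟩ʳ b) ≡ + toℕ (π ⟨$⟩ʳ a) + (k - q b + q a) * N
        residue = trans (expand (+ toℕ (π ⟨$⟩ʳ a)) (+ toℕ (π ⟨$⟩ʳ b)) (q a) (q b) N)
          (trans (cong (_+ (+ toℕ (π ⟨$⟩ʳ a) + (q a - q b) * N)) eq) (collect (+ toℕ (π ⟨$⟩ʳ a)) (q a) (q b) k N))

      T-distinct : ∀ {a b} → a ≢ b → (T b - T a) ∤ₙ
      T-distinct {a} {b} a≢b k eq = a≢b (sym (residues-distinct b a k (trans (expand (T a) (T b)) (cong (_+_ (T a)) eq))))
        where
        expand : ∀ a b → b ≡ a + (b - a)
        expand = solve-∀

      -- Off the diagonal both floors change sign up to the same - 1, which cancels; on the diagonal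
      -- both floors agree.
      D-antisym : ∀ a b → D b a ≡ - D a b
      D-antisym a b with a ≟ b
      ... | yes refl = trans (cong₂ (λ x y → ⌊ x ⌋ - ⌊ y ⌋) (+-inverseʳ (P a)) (+-inverseʳ (T a))) (trans (+-inverseʳ ⌊ 0ℤ ⌋)
        (sym (trans (cong₂ (λ x y → - (⌊ x ⌋ - ⌊ y ⌋)) (+-inverseʳ (P a)) (+-inverseʳ (T a))) (cong -_ (+-inverseʳ ⌊ 0ℤ ⌋)))))
      ... | no  a≢b = trans (cong₂ _-_ (flipped (P a) (P b) (P-distinct a≢b)) (flipped (T a) (T b) (T-distinct a≢b)))
        (cancel (X a b) (Y a b))
        where
        negate : ∀ x y → x - y ≡ - (y - x)
        negate = solve-∀
        flipped : ∀ x y → (y - x) ∤ₙ → ⌊ x - y ⌋ ≡ - + 1 - ⌊ y - x ⌋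
        flipped x y ∤ = trans (cong ⌊_⌋ (negate x y)) (⌊⌋-neg (y - x) ∤)
        cancel : ∀ x y → - + 1 - x - (- + 1 - y) ≡ - (x - y)
        cancel = solve-∀

      -- Row and column sums of floors.

      module _ (∑q : ∑[ i < n ] q i ≡ 0ℤ) where

        ∑d≡0 : ∑[ i < n ] d i ≡ 0ℤ
        ∑d≡0 = trans (∑-distrib-- {n} T P) (trans (cong₂ _-_ (∑-permute {n} T π) ∑P) (+-inverseʳ ∑π))
          where
          ∑π = ∑[ i < n ] T (π ⟨$⟩ʳ i)
          ∑qN : ∑[ i < n ] (q i * N) ≡ 0ℤ
          ∑qN = trans (sum-cong-≗ {n} (λ i → *-comm (q i) N)) (trans (∑-distrib-* {n} N q) (trans (cong (_*_ N) ∑q) (*-zeroʳ N)))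
          ∑P : ∑[ i < n ] P i ≡ ∑π
          ∑P = trans (∑-distrib-+ {n} (λ i → T (π ⟨$⟩ʳ i)) (λ i → q i * N)) (trans (cong (_+_ ∑π) ∑qN) (+-identityʳ ∑π))

        -- The windings come out of the floors and add up to 0; the rest is a reindexing by `π`.
        -- Thus Hermite's identity for `T` also serves for `P`.
        ∑⌊z+P⌋ : ∀ z → ∑[ b < n ] ⌊ z + P b ⌋ ≡ ∑[ b < n ] ⌊ z + T b ⌋
        ∑⌊z+P⌋ z =
          trans (sum-cong-≗ {n} (λ b → trans (cong ⌊_⌋ (sym (+-assoc z (T (π ⟨$⟩ʳ b)) (q b * N)))) (⌊⌋-shift (z + T (π ⟨$⟩ʳ b)) (q b))))
          (trans (∑-distrib-+ {n} (λ b → ⌊ z + T (π ⟨$⟩ʳ b) ⌋) q)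
          (trans (cong (_+_ (∑[ b < n ] ⌊ z + T (π ⟨$⟩ʳ b) ⌋)) ∑q)
          (trans (+-identityʳ _) (sym (∑-permute {n} (λ b → ⌊ z + T b ⌋) π)))))

        -- Each crossing moves a lift by one, so the signed crossings of `a` add up to its
        -- displacement.
        ∑-row-D : ∀ a → ∑[ b < n ] D a b ≡ d a
        ∑-row-D a = trans (∑-distrib-- {n} (X a) (Y a))
          (trans (cong₂ _-_
            (trans (sum-cong-≗ {n} (λ b → cong ⌊_⌋ (+-comm (P b) (- P a)))) (∑⌊z+P⌋ (- P a)))
            (sum-cong-≗ {n} (λ b → cong ⌊_⌋ (+-comm (T b) (- T a)))))
          (trans (Hermite-+ (- P a) (- T a)) (eq (P a) (T a))))
          where
          eq : ∀ p t → - p - - t ≡ t - p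
          eq = solve-∀

        module _ (θ : ℤ) where

          -- A mixture of start and target: for fixed `a` it differs from `X` by a constant inside
          -- the floor, and for fixed `b` likewise from `Y`. Hermite's identity therefore sums
          -- `W - X` along rows and `W - Y` along columns.
          W : Fin n → Fin n → ℤ
          W a b = ⌊ P b + θ - T a ⌋

          ∑-row-W-X : ∀ a → ∑[ b < n ] (W a b - X a b) ≡ θ - d a
          ∑-row-W-X a = trans (∑-distrib-- {n} (W a) (X a))
            (trans (cong₂ _-_
              (trans (sum-cong-≗ {n} (λ b → cong ⌊_⌋ (move (P b) θ (T a)))) (∑⌊z+P⌋ (θ - T a)))
              (trans (sum-cong-≗ {n} (λ b → cong ⌊_⌋ (+-comm (P b) (- P a)))) (∑⌊z+P⌋ (- P a))))
            (trans (Hermite-+ (θ - T a) (- P a)) (eq (P a) (T a) θ)))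
            where
            move : ∀ p θ t → p + θ - t ≡ θ - t + p
            move = solve-∀
            eq : ∀ p t θ → θ - t - - p ≡ θ - (t - p)
            eq = solve-∀

          ∑-column-W-Y : ∀ b → ∑[ a < n ] (W a b - Y a b) ≡ θ - d b
          ∑-column-W-Y b = trans (∑-distrib-- {n} (λ a → W a b) (λ a → Y a b))
            (trans (Hermite-- (P b + θ) (T b)) (eq (P b) (T b) θ))
            where
            eq : ∀ p t θ → p + θ - t ≡ θ - (t - p)
            eq = solve-∀

          -- Bounding the total number of crossings.

          module _ (d≤θ : ∀ i → d i ≤ θ) (θ≤d+N : ∀ i → θ ≤ d i + N) where

            -- Here and in the next bounds, the range of `d b` compares `W` with `Y`, and the range
            -- of `d a` compares `W` with `X`; a spread of n allows floors to differ by at most one.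
            Y≤W : ∀ a b → Y a b ≤ W a b
            Y≤W a b = ⌊⌋-mono (≤-by-difference (d≤θ b) (eq (P b) (T b) (T a) θ))
              where
              eq : ∀ p t t′ θ → θ - (t - p) ≡ p + θ - t′ - (t - t′)
              eq = solve-∀

            X≤W : ∀ a b → X a b ≤ W a b
            X≤W a b = ⌊⌋-mono (≤-by-difference (d≤θ a) (eq (P b) (P a) (T a) θ))
              where
              eq : ∀ p p′ t θ → θ - (t - p′) ≡ p + θ - t - (p - p′)
              eq = solve-∀

            ⌊⌋≤⌊⌋+1 : ∀ x y → x ≤ y + + 1 * N → ⌊ x ⌋ ≤ ⌊ y ⌋ + + 1
            ⌊⌋≤⌊⌋+1 x y h = ≤-trans (⌊⌋-mono h) (≤-reflexive (⌊⌋-shift y (+ 1)))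

            W≤Y+1 : ∀ a b → W a b ≤ Y a b + + 1
            W≤Y+1 a b = ⌊⌋≤⌊⌋+1 (P b + θ - T a) (T b - T a) (≤-by-difference (θ≤d+N b) (eq (P b) (T b) (T a) θ N))
              where
              eq : ∀ p t t′ θ N → t - p + N - θ ≡ t - t′ + + 1 * N - (p + θ - t′)
              eq = solve-∀

            W≤X+1 : ∀ a b → W a b ≤ X a b + + 1
            W≤X+1 a b = ⌊⌋≤⌊⌋+1 (P b + θ - T a) (P b - P a) (≤-by-difference (θ≤d+N a) (eq (P b) (P a) (T a) θ N))
              where
              eq : ∀ p p′ t θ N → t - p′ + N - θ ≡ p - p′ + + 1 * N - (p + θ - t)
              eq = solve-∀

            -- Each entry of `Φ` is at most `Q a b + Q b a`, so `Φ` is at most twice the sum of `Q`,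
            -- which can be evaluated exactly.
            Φ-bound : (s : Fin n → Bool) (m : ℤ) → ∑[ i < n ] 𝟙 (s i) ≡ m →
              (∀ a b → s a ≡ true → s b ≡ false → d a ≤ d b) →
              Φ ≤ + 2 * (m * m + (N - + 2 * m) * θ)
            Φ-bound s m ∑s smallest = ≤-trans
              (∑-mono-≤ {n} (λ a → ∑-mono-≤ {n} (λ b → pointwise a b)))
              (≤-reflexive (trans (sum-cong-≗ {n} (λ a → ∑-distrib-+ {n} (Q a) (λ b → Q b a)))
                (trans (∑-distrib-+ {n} (λ a → ∑[ b < n ] Q a b) (λ a → ∑[ b < n ] Q b a))
                (trans (cong (_+_ ΣQ) (∑-comm {n} {n} (λ a b → Q b a)))
                (trans (cong (λ z → z + z) ΣQ≡) (double (m * m + (N - + 2 * m) * θ)))))))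
              where
              double : ∀ z → z + z ≡ + 2 * z
              double = solve-∀

              Q : Fin n → Fin n → ℤ
              Q a b = share (s a) (s b) (X a b) (Y a b) (W a b)

              ΣQ : ℤ
              ΣQ = ∑[ a < n ] ∑[ b < n ] Q a b

              X≤Y : ∀ a b → d a ≤ d b → X a b ≤ Y a b
              X≤Y a b da≤db = ⌊⌋-mono (≤-by-difference da≤db (eq (T a) (P a) (T b) (P b)))
                where
                eq : ∀ t p t′ p′ → t′ - p′ - (t - p) ≡ t′ - t - (p′ - p)
                eq = solve-∀

              pointwise : ∀ a b → + ∣ D a b ∣ ≤ Q a b + Q b a
              pointwise a b = crossing≤shares (s a) (s b) (X a b) (Y a b) (W a b) (X b a) (Y b a) (W b a)
                (X≤W a b) (W≤X+1 a b) (Y≤W a b) (W≤Y+1 a b) (X≤W b a) (W≤X+1 b a) (Y≤W b a) (W≤Y+1 b a)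
                (trans (isolate (X b a) (Y b a)) (cong (_+ Y b a) (D-antisym a b))) (λ sa sb → X≤Y a b (smallest a b sa sb)) (λ sb sa → X≤Y b a (smallest b a sb sa))
                where
                isolate : ∀ x y → x ≡ x - y + y
                isolate = solve-∀

              t : Fin n → ℤ
              t b = + 1 - 𝟙 (s b)

              row : ∀ a → ∑[ b < n ] (+ 1 - (W a b - X a b) - + 2 * D a b) ≡ N - θ - d a
              row a = trans (∑-distrib-- {n} (λ b → + 1 - (W a b - X a b)) (λ b → + 2 * D a b))
                (trans (cong₂ _-_
                  (trans (∑-distrib-- {n} (λ _ → + 1) (λ b → W a b - X a b)) (cong₂ _-_ (∑-const {n} (+ 1)) (∑-row-W-X a)))
                  (trans (∑-distrib-* {n} (+ 2) (D a)) (cong (_*_ (+ 2)) (∑-row-D a))))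
                (eq N θ (d a)))
                where
                eq : ∀ N θ d → N * + 1 - (θ - d) - + 2 * d ≡ N - θ - d
                eq = solve-∀

              ∑t : ∑[ b < n ] t b ≡ N - m
              ∑t = trans (∑-distrib-- {n} (λ _ → + 1) (𝟙 ∘ s)) (cong₂ _-_ (trans (∑-const {n} (+ 1)) (*-identityʳ N)) ∑s)

              -- The three terms of `share`: the first factors along rows, the second along columns,
              -- and the third counts pairs from the selected set to its complement.
              ΣU ΣV ΣZ : ℤ
              ΣU = ∑[ a < n ] ∑[ b < n ] (𝟙 (s a) * (+ 1 - (W a b - X a b) - + 2 * D a b))
              ΣV = ∑[ a < n ] ∑[ b < n ] (t b * (W a b - Y a b))
              ΣZ = ∑[ a < n ] ∑[ b < n ] (𝟙 (s a) * t b)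

              ΣU≡ : ΣU ≡ ∑[ a < n ] (𝟙 (s a) * (N - θ - d a))
              ΣU≡ = sum-cong-≗ {n} (λ a → trans (∑-distrib-* {n} (𝟙 (s a)) (λ b → + 1 - (W a b - X a b) - + 2 * D a b))
                (cong (_*_ (𝟙 (s a))) (row a)))

              ΣV≡ : ΣV ≡ ∑[ b < n ] (t b * (θ - d b))
              ΣV≡ = trans (∑-comm {n} {n} (λ a b → t b * (W a b - Y a b)))
                (sum-cong-≗ {n} (λ b → trans (∑-distrib-* {n} (t b) (λ a → W a b - Y a b)) (cong (_*_ (t b)) (∑-column-W-Y b))))

              ΣZ≡ : ΣZ ≡ (N - m) * m
              ΣZ≡ = trans (sum-cong-≗ {n} (λ a → trans (∑-distrib-* {n} (𝟙 (s a)) t) (trans (cong (_*_ (𝟙 (s a))) ∑t) (*-comm (𝟙 (s a)) (N - m)))))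
                (trans (∑-distrib-* {n} (N - m) (𝟙 ∘ s)) (cong (_*_ (N - m)) ∑s))

              -- Every `d a` enters with total weight - 1, selected or not, so the displacements sum
              -- to 0 and only the size `m` of the selection remains.
              ΣU+ΣV : ΣU + ΣV ≡ (N - + 2 * θ) * m + N * θ
              ΣU+ΣV = trans (cong₂ _+_ ΣU≡ ΣV≡)
                (trans (sym (∑-distrib-+ {n} (λ a → 𝟙 (s a) * (N - θ - d a)) (λ b → t b * (θ - d b))))
                (trans (sum-cong-≗ {n} (λ a → eq (𝟙 (s a)) N θ (d a)))
                (trans (∑-distrib-+ {n} (λ a → (N - + 2 * θ) * 𝟙 (s a)) (λ a → θ - d a))
                (cong₂ _+_
                  (trans (∑-distrib-* {n} (N - + 2 * θ) (𝟙 ∘ s)) (cong (_*_ (N - + 2 * θ)) ∑s))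
                  (trans (∑-distrib-- {n} (λ _ → θ) d) (trans (cong₂ _-_ (∑-const {n} θ) ∑d≡0) (+-identityʳ (N * θ))))))))
                where
                eq : ∀ s N θ d → s * (N - θ - d) + (+ 1 - s) * (θ - d) ≡ (N - + 2 * θ) * s + (θ - d)
                eq = solve-∀

              ΣQ≡ : ΣQ ≡ m * m + (N - + 2 * m) * θ
              ΣQ≡ = trans (sum-cong-≗ {n} (λ a → trans
                  (∑-distrib-+ {n} (λ b → 𝟙 (s a) * (+ 1 - (W a b - X a b) - + 2 * D a b)) (λ b → t b * (W a b - Y a b) - 𝟙 (s a) * t b))
                  (cong (_+_ (∑[ b < n ] (𝟙 (s a) * (+ 1 - (W a b - X a b) - + 2 * D a b))))
                    (∑-distrib-- {n} (λ b → t b * (W a b - Y a b)) (λ b → 𝟙 (s a) * t b)))))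
                (trans (∑-distrib-+ {n} (λ a → ∑[ b < n ] (𝟙 (s a) * (+ 1 - (W a b - X a b) - + 2 * D a b)))
                  (λ a → ∑[ b < n ] (t b * (W a b - Y a b)) - ∑[ b < n ] (𝟙 (s a) * t b)))
                (trans (cong (_+_ ΣU) (∑-distrib-- {n} (λ a → ∑[ b < n ] (t b * (W a b - Y a b))) (λ a → ∑[ b < n ] (𝟙 (s a) * t b))))
                (trans (sym (+-assoc ΣU ΣV (- ΣZ)))
                (trans (cong₂ _-_ ΣU+ΣV ΣZ≡) (eq N m θ)))))
                where
                eq : ∀ N m θ → (N - + 2 * θ) * m + N * θ - (N - m) * m ≡ m * m + (N - + 2 * m) * θ
                eq = solve-∀

    -- Windings whose displacements spread over at most n.

    residue-shift : (i p : Fin n) → ∃[ b ]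
      0ℤ ≤ + toℕ i - + toℕ p + 𝟙 b * N × + toℕ i - + toℕ p + 𝟙 b * N ≤ N
    residue-shift i p with toℕ i ℕ.<? toℕ p
    ... | yes i<p = true
      , ≤-by-difference (+-mono-≤ (+≤+ (ℕ.z≤n {toℕ i})) (+≤+ (ℕ.<⇒≤ (toℕ<n p)))) (lower (+ toℕ i) (+ toℕ p) N)
      , ≤-by-difference (+≤+ (ℕ.<⇒≤ i<p)) (upper (+ toℕ i) (+ toℕ p) N)
      where
      lower : ∀ i p N → i + N - (+ 0 + p) ≡ i - p + + 1 * N - + 0
      lower = solve-∀
      upper : ∀ i p N → p - i ≡ N - (i - p + + 1 * N)
      upper = solve-∀
    ... | no i≮p = false
      , ≤-by-difference (+≤+ (ℕ.≮⇒≥ i≮p)) (lower (+ toℕ i) (+ toℕ p) N)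
      , ≤-by-difference (+-mono-≤ (+≤+ (ℕ.z≤n {toℕ p})) (+≤+ (ℕ.<⇒≤ (toℕ<n i)))) (upper (+ toℕ i) (+ toℕ p) N)
      where
      lower : ∀ i p N → i - p ≡ i - p + + 0 * N - + 0
      lower = solve-∀
      upper : ∀ i p N → p + N - (+ 0 + i) ≡ N - (i - p + + 0 * N)
      upper = solve-∀

    -- The displacements e i ≡ i − π i (mod n) in [0 , n] add up to n times the
    -- number m of positive shifts; lowering the m largest by n restores the sum
    -- 0 and keeps the spread within n.
    balanced-winding : (π : Permutation′ n) → Σ[ q ∈ (Fin n → ℤ) ] ∑[ i < n ] q i ≡ 0ℤ ×
      ∃[ θ ] (∀ i → Lift.d π q i ≤ θ) × (∀ i → θ ≤ Lift.d π q i + N)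
    balanced-winding π = q , ∑q , d (proj₁ maximum) , proj₂ maximum , λ i →
      subst₂ (λ x y → x ≤ y + N) (sym (d≡e-sN (proj₁ maximum))) (sym (d≡e-sN i)) (spread (proj₁ maximum) i)
      where
      g : Fin n → Bool
      g i = proj₁ (residue-shift i (π ⟨$⟩ʳ i))

      e : Fin n → ℤ
      e i = + toℕ i - + toℕ (π ⟨$⟩ʳ i) + 𝟙 (g i) * N

      e≥0 : ∀ i → 0ℤ ≤ e i
      e≥0 i = proj₁ (proj₂ (residue-shift i (π ⟨$⟩ʳ i)))

      e≤N : ∀ i → e i ≤ N
      e≤N i = proj₂ (proj₂ (residue-shift i (π ⟨$⟩ʳ i)))

      m = proj₁ (count g)

      selection = select-smallest (λ i → - e i) m (proj₁ (proj₂ (count g)))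

      s : Fin n → Bool
      s = proj₁ selection

      q : Fin n → ℤ
      -- Raising a displacement by n lowers the winding by one, hence the minus sign at `g`.
      q i = 𝟙 (s i) - 𝟙 (g i)

      ∑q : ∑[ i < n ] q i ≡ 0ℤ
      ∑q = trans (∑-distrib-- {n} (𝟙 ∘ s) (𝟙 ∘ g))
        (trans (cong₂ _-_ (proj₁ (proj₂ selection)) (proj₂ (proj₂ (count g)))) (+-inverseʳ (+ m)))

      d : Fin n → ℤ
      d = Lift.d π q

      d≡e-sN : ∀ i → d i ≡ e i - 𝟙 (s i) * N
      d≡e-sN i = eq (+ toℕ i) (+ toℕ (π ⟨$⟩ʳ i)) (𝟙 (s i)) (𝟙 (g i)) N
        where
        eq : ∀ i p s g N → i - (p + (s - g) * N) ≡ i - p + g * N - s * N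
        eq = solve-∀

      spread : ∀ a b → e a - 𝟙 (s a) * N ≤ e b - 𝟙 (s b) * N + N
      spread a b with s a in sa | s b in sb
      ... | true  | true  = ≤-by-difference (+-mono-≤ (e≥0 b) (e≤N a)) (eq (e a) (e b) N)
        where
        eq : ∀ e f N → f + N - (+ 0 + e) ≡ f - + 1 * N + N - (e - + 1 * N)
        eq = solve-∀
      ... | false | false = ≤-by-difference (+-mono-≤ (e≥0 b) (e≤N a)) (eq (e a) (e b) N)
        where
        eq : ∀ e f N → f + N - (+ 0 + e) ≡ f - + 0 * N + N - (e - + 0 * N)
        eq = solve-∀
      ... | true  | false = ≤-by-difference (+-mono-≤ (+-mono-≤ (e≥0 b) (e≤N a)) (+≤+ (ℕ.z≤n {n}))) (eq (e a) (e b) N)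
        where
        eq : ∀ e f N → f + N + N - (+ 0 + e + + 0) ≡ f - + 0 * N + N - (e - + 1 * N)
        eq = solve-∀
      -- Only `b` is lowered, so `e a ≤ e b` because the lowered elements are the largest.
      ... | false | true  = ≤-by-difference (proj₂ (proj₂ selection) b a sb sa) (eq (e a) (e b) N)
        where
        eq : ∀ e f N → - e - - f ≡ f - + 1 * N + N - (e - + 0 * N)
        eq = solve-∀

      maximum : ∃[ x ] ∀ i → d i ≤ d x
      maximum with minimum-unselected (λ i → - d i) (λ _ → false)
      ... | inj₁ all = contradiction (all Fin.zero) λ ()
      ... | inj₂ (x , _ , min) = x , λ i → neg-cancel-≤ (min i refl)

    -- The effect of one swap on the crossings.

    -- The winding w is 1 for the pair (n - 1 , 0) and 0 otherwise.
    module Step (π : Permutation′ n) (q : Fin n → ℤ) (i j : Fin n) (w : ℤ)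
      (adjacent : + toℕ (π ⟨$⟩ʳ i) + + 1 ≡ + toℕ (π ⟨$⟩ʳ j) + w * N)
      (descent : Lift.d π q j < Lift.d π q i) where

      open Lift π q

      π′ : Permutation′ n
      π′ = applyTransposition π (π ⟨$⟩ʳ i , π ⟨$⟩ʳ j)

      -- When the swap wraps around, `i` gains a turn and `j` loses one, so that their lifts still
      -- move by exactly one.
      q′ : Fin n → ℤ
      q′ k = q k + w * (δ i k - δ j k)

      module L′ = Lift π′ q′

      i≢j : i ≢ j
      i≢j refl = <-irrefl refl descent

      π-injective : ∀ {a b} → π ⟨$⟩ʳ a ≡ π ⟨$⟩ʳ b → a ≡ b
      π-injective eq = trans (sym (inverseˡ π)) (trans (cong (π ⟨$⟩ˡ_) eq) (inverseˡ π))

      P′i : L′.P i ≡ P i + + 1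
      P′i = trans (cong₂ (λ x y → + toℕ x + y * N) (transpose-first (π ⟨$⟩ʳ i) (π ⟨$⟩ʳ j))
          (cong₂ (λ x y → q i + w * (x - y)) (δ-same i) (δ-other i≢j)))
        (trans (eq₁ (+ toℕ (π ⟨$⟩ʳ j)) (q i) w N) (trans (cong (_+ q i * N) (sym adjacent)) (eq₂ (+ toℕ (π ⟨$⟩ʳ i)) (q i) N)))
        where
        eq₁ : ∀ p q w N → p + (q + w * (+ 1 - + 0)) * N ≡ p + w * N + q * N
        eq₁ = solve-∀
        eq₂ : ∀ p q N → p + + 1 + q * N ≡ p + q * N + + 1
        eq₂ = solve-∀

      P′j : L′.P j ≡ P j - + 1
      P′j = trans (cong₂ (λ x y → + toℕ x + y * N) (transpose-second (π ⟨$⟩ʳ i) (π ⟨$⟩ʳ j))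
          (cong₂ (λ x y → q j + w * (x - y)) (δ-other (i≢j ∘ sym)) (δ-same j)))
        (trans (eq₁ (+ toℕ (π ⟨$⟩ʳ i)) (q j) w N) (trans (cong (λ x → x - + 1 + (q j - w) * N) adjacent) (eq₂ (+ toℕ (π ⟨$⟩ʳ j)) (q j) w N)))
        where
        eq₁ : ∀ p q w N → p + (q + w * (+ 0 - + 1)) * N ≡ p + + 1 - + 1 + (q - w) * N
        eq₁ = solve-∀
        eq₂ : ∀ p q w N → p + w * N - + 1 + (q - w) * N ≡ p + q * N - + 1
        eq₂ = solve-∀

      P′-other : ∀ {k} → k ≢ i → k ≢ j → L′.P k ≡ P k
      P′-other {k} k≢i k≢j = trans (cong₂ (λ x y → + toℕ x + y * N)
          (transpose-other (π ⟨$⟩ʳ i) (π ⟨$⟩ʳ j) (π ⟨$⟩ʳ k) (k≢i ∘ π-injective) (k≢j ∘ π-injective))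
          (cong₂ (λ x y → q k + w * (x - y)) (δ-other k≢i) (δ-other k≢j)))
        (eq (+ toℕ (π ⟨$⟩ʳ k)) (q k) w N)
        where
        eq : ∀ p q w N → p + (q + w * (+ 0 - + 0)) * N ≡ p + q * N
        eq = solve-∀

      -- The lift of `j` moved back by r n is directly ahead of the lift of `i`; these are the lifts
      -- that the swap exchanges.
      r : ℤ
      r = q j - q i - w

      Pj-Pi : P j - P i ≡ r * N + + 1
      Pj-Pi = trans (eq₁ (+ toℕ (π ⟨$⟩ʳ j)) (+ toℕ (π ⟨$⟩ʳ i)) (q j) (q i) w N)
        (trans (cong (λ x → x - (+ toℕ (π ⟨$⟩ʳ i) + + 1) + r * N + + 1) (sym adjacent))
          (eq₂ (+ toℕ (π ⟨$⟩ʳ i)) (r * N)))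
        where
        eq₁ : ∀ p′ p q′ q w N → p′ + q′ * N - (p + q * N) ≡ p′ + w * N - (p + + 1) + (q′ - q - w) * N + + 1
        eq₁ = solve-∀
        eq₂ : ∀ p s → p + + 1 - (p + + 1) + s + + 1 ≡ s + + 1
        eq₂ = solve-∀

      X-ij : X i j ≡ r
      X-ij = trans (cong ⌊_⌋ Pj-Pi) (trans (⌊⌋-suc-∤ (r * N) (λ k eq → P-distinct i≢j k (trans Pj-Pi eq))) (⌊multiple⌋ r))

      X′-ij : L′.X i j ≡ r - + 1
      X′-ij = ⌊⌋-suc-∣ (L′.P j - L′.P i) r (trans (cong₂ (λ x y → x - y + + 1) P′j P′i)
        (trans (eq₁ (P j) (P i)) (trans (cong (_- + 1) Pj-Pi) (eq₂ (r * N)))))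
        where
        eq₁ : ∀ x y → x - + 1 - (y + + 1) + + 1 ≡ x - y - + 1
        eq₁ = solve-∀
        eq₂ : ∀ x → x + + 1 - + 1 ≡ x
        eq₂ = solve-∀

      -- The descent says T j - T i < P j - P i = r n + 1, and the value r n is excluded by `i≢j`.
      -- Hence the crossing made by the swap was still due.
      Y-ij : Y i j < r
      Y-ij = ⌊⌋< r (T j - T i) (≤∧≢⇒< (≤-by-difference (<⇒1+≤ descent)
          (trans (eq₁ (T i) (P i) (T j) (P j)) (trans (cong (λ x → x - + 1 - (T j - T i)) Pj-Pi) (eq₂ (r * N) (T j - T i)))))
        (T-distinct i≢j r))
        where
        eq₁ : ∀ t p t′ p′ → t - p - (t′ - p′ + + 1) ≡ p′ - p - + 1 - (t′ - t)
        eq₁ = solve-∀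
        eq₂ : ∀ x y → x + + 1 - + 1 - y ≡ x - y
        eq₂ = solve-∀

      D′-ij : L′.D i j ≡ D i j - + 1
      D′-ij = trans (cong (_- Y i j) X′-ij) (trans (eq r (Y i j)) (cong (λ x → x - Y i j - + 1) (sym X-ij)))
        where
        eq : ∀ r y → r - + 1 - y ≡ r - y - + 1
        eq = solve-∀

      D-ij≥1 : + 1 ≤ D i j
      D-ij≥1 = ≤-by-difference (<⇒1+≤ Y-ij) (trans (eq r (Y i j)) (cong (λ x → x - Y i j - + 1) (sym X-ij)))
        where
        eq : ∀ r y → r - (y + + 1) ≡ r - y - + 1
        eq = solve-∀

      -- `P b - P i` drops by one from a non-multiple of n, which keeps its floor.
      D′-i : ∀ {b} → b ≢ i → b ≢ j → L′.D i b ≡ D i b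
      D′-i {b} b≢i b≢j = cong (_- Y i b) (trans (cong ⌊_⌋ (cong₂ _-_ (P′-other b≢i b≢j) P′i))
        (trans (sym (⌊⌋-suc-∤ (P b - (P i + + 1)) (λ k eq → P-distinct (b≢i ∘ sym) k (trans (sym (shift (P b) (P i))) eq))))
          (cong ⌊_⌋ (shift (P b) (P i)))))
        where
        shift : ∀ x y → x - (y + + 1) + + 1 ≡ x - y
        shift = solve-∀

      D′-j : ∀ {b} → b ≢ i → b ≢ j → L′.D j b ≡ D j b
      D′-j {b} b≢i b≢j = cong (_- Y j b) (trans (cong ⌊_⌋ (trans (cong₂ _-_ (P′-other b≢i b≢j) P′j) (shift (P b) (P j))))
        -- `P j - + 1` is congruent to `P i` modulo n, so a multiple here would make `b` and `i`
        -- share a residue.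
        (⌊⌋-suc-∤ (P b - P j) (λ k eq → P-distinct (b≢i ∘ sym) (k + r)
          (trans (eq₁ (P b) (P i) (P j)) (trans (cong₂ _+_ eq (cong (_- + 1) Pj-Pi)) (eq₂ k r N))))))
        where
        shift : ∀ x y → x - (y - + 1) ≡ x - y + + 1
        shift = solve-∀
        eq₁ : ∀ x y z → x - y ≡ x - z + + 1 + (z - y - + 1)
        eq₁ = solve-∀
        eq₂ : ∀ k r N → k * N + (r * N + + 1 - + 1) ≡ (k + r) * N
        eq₂ = solve-∀

      D-diagonal : ∀ a → L′.D a a ≡ D a a
      D-diagonal a = cong (λ x → ⌊ x ⌋ - Y a a) (trans (+-inverseʳ (L′.P a)) (sym (+-inverseʳ (P a))))

      mirror : ∀ {a b} → L′.D a b ≡ D a b → L′.D b a ≡ D b a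
      mirror {a} {b} eq = trans (L′.D-antisym a b) (trans (cong -_ eq) (sym (D-antisym a b)))

      ∣D∣-ij : + ∣ L′.D i j ∣ + + 1 ≡ + ∣ D i j ∣
      ∣D∣-ij = trans (cong (λ x → + ∣ x ∣ + + 1) D′-ij) (∣-1∣ (D i j) D-ij≥1)

      ∣∣-mirror : ∀ x y → y ≡ - x → ∣ y ∣ ≡ ∣ x ∣
      ∣∣-mirror x y eq = trans (cong ∣_∣ eq) (∣-i∣≡∣i∣ x)

      ∣D∣-ji : + ∣ L′.D j i ∣ + + 1 ≡ + ∣ D j i ∣
      ∣D∣-ji = trans (cong (λ x → + x + + 1) (∣∣-mirror (L′.D i j) (L′.D j i) (L′.D-antisym i j)))
        (trans ∣D∣-ij (cong +_ (sym (∣∣-mirror (D i j) (D j i) (D-antisym i j)))))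

      ∣D∣-change : ∀ a b → + ∣ L′.D a b ∣ + (δ i a * δ j b + δ j a * δ i b) ≡ + ∣ D a b ∣
      ∣D∣-change = lower-symmetric-pair (λ a b → + ∣ L′.D a b ∣) (λ a b → + ∣ D a b ∣) i≢j ∣D∣-ij ∣D∣-ji
        (λ a → cong (λ x → + ∣ x ∣) (D-diagonal a))
        (λ b≢i b≢j → cong (λ x → + ∣ x ∣) (D′-i b≢i b≢j))
        (λ b≢i b≢j → cong (λ x → + ∣ x ∣) (D′-j b≢i b≢j))
        (λ a≢i a≢j → cong (λ x → + ∣ x ∣) (mirror (D′-i a≢i a≢j)))
        (λ a≢i a≢j → cong (λ x → + ∣ x ∣) (mirror (D′-j a≢i a≢j)))
        (λ {a} {b} a≢i a≢j b≢i b≢j → cong (λ x → + ∣ ⌊ x ⌋ - Y a b ∣) (cong₂ _-_ (P′-other b≢i b≢j) (P′-other a≢i a≢j)))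

      ∑δδ : ∀ (x y : Fin n) → ∑[ a < n ] ∑[ b < n ] (δ x a * δ y b) ≡ + 1
      ∑δδ x y = trans (sum-cong-≗ {n} (λ a → trans (∑-distrib-* {n} (δ x a) (δ y)) (trans (cong (_*_ (δ x a)) (∑-δ y)) (*-identityʳ (δ x a)))))
        (∑-δ x)

      -- The one crossing saved is counted at (i , j) and at (j , i).
      Φ-drop : L′.Φ + + 2 ≡ Φ
      Φ-drop = sym (trans (sum-cong-≗ {n} (λ a → trans (sum-cong-≗ {n} (λ b → sym (∣D∣-change a b)))
          (trans (∑-distrib-+ {n} (λ b → + ∣ L′.D a b ∣) (λ b → δ i a * δ j b + δ j a * δ i b))
            (cong (_+_ (∑[ b < n ] (+ ∣ L′.D a b ∣))) (∑-distrib-+ {n} (λ b → δ i a * δ j b) (λ b → δ j a * δ i b))))))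
        (trans (∑-distrib-+ {n} (λ a → ∑[ b < n ] (+ ∣ L′.D a b ∣)) (λ a → ∑[ b < n ] (δ i a * δ j b) + ∑[ b < n ] (δ j a * δ i b)))
        (cong (_+_ L′.Φ) (trans (∑-distrib-+ {n} (λ a → ∑[ b < n ] (δ i a * δ j b)) (λ a → ∑[ b < n ] (δ j a * δ i b)))
          (cong₂ _+_ (∑δδ i j) (∑δδ j i))))))

      2≤Φ : 0ℤ ≤ L′.Φ → + 2 ≤ Φ
      2≤Φ Φ′≥0 = subst (+ 2 ≤_) Φ-drop (+-monoˡ-≤ (+ 2) Φ′≥0)

      Φ′≤ : ∀ ℓ → Φ ≤ + 2 + ℓ → L′.Φ ≤ ℓ
      Φ′≤ ℓ Φ≤ = ≤-by-difference (subst (_≤ + 2 + ℓ) (sym Φ-drop) Φ≤) (eq L′.Φ ℓ)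
        where
        eq : ∀ x ℓ → + 2 + ℓ - (x + + 2) ≡ ℓ - x
        eq = solve-∀

      ∑q′ : ∑[ k < n ] q k ≡ 0ℤ → ∑[ k < n ] q′ k ≡ 0ℤ
      ∑q′ ∑q = trans (∑-distrib-+ {n} q (λ k → w * (δ i k - δ j k)))
        (trans (cong₂ _+_ ∑q (trans (∑-distrib-* {n} w (λ k → δ i k - δ j k))
          (trans (cong (_*_ w) (trans (∑-distrib-- {n} (δ i) (δ j)) (cong₂ _-_ (∑-δ i) (∑-δ j)))) (*-zeroʳ w)))) refl)

    -- Finding descents and sorting by them.

    Descent : Permutation′ n → (Fin n → ℤ) → Set
    Descent π q = ∃[ i ] ∃[ j ] ∃[ w ] CyclicallyAdjacent (π ⟨$⟩ʳ i , π ⟨$⟩ʳ j) ×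
      + toℕ (π ⟨$⟩ʳ i) + + 1 ≡ + toℕ (π ⟨$⟩ʳ j) + w * N × Lift.d π q j < Lift.d π q i

    descent-at : ∀ π q p p′ w → CyclicallyAdjacent (p , p′) → + toℕ p + + 1 ≡ + toℕ p′ + w * N →
      Lift.d π q (π ⟨$⟩ˡ p′) < Lift.d π q (π ⟨$⟩ˡ p) → Descent π q
    descent-at π q p p′ w adj eq d< = π ⟨$⟩ˡ p , π ⟨$⟩ˡ p′ , w
      , subst₂ (λ x y → CyclicallyAdjacent (x , y)) (sym (inverseʳ π)) (sym (inverseʳ π)) adj
      , subst₂ (λ x y → + toℕ x + + 1 ≡ + toℕ y + w * N) (sym (inverseʳ π)) (sym (inverseʳ π)) eq
      , d<

    descent-or-still : ∀ π q → ∑[ i < n ] q i ≡ 0ℤ → Descent π q ⊎ (∀ i → Lift.d π q i ≡ 0ℤ)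
    descent-or-still π q ∑q = search
      where
      open Lift π q
      g : Fin n → ℤ
      g p = d (π ⟨$⟩ˡ p)

      search : Descent π q ⊎ (∀ i → d i ≡ 0ℤ)
      search with any? (λ k → g (Fin.suc k) <? g (inject₁ k)) | g Fin.zero <? g (fromℕ n-1)
      ... | yes (k , g<) | _ = inj₁ (descent-at π q (inject₁ k) (Fin.suc k) 0ℤ
        (inj₁ (cong ℕ.suc (sym (toℕ-inject₁ k))))
        (trans (cong (λ x → + x + + 1) (toℕ-inject₁ k)) (trans (+-comm (+ toℕ k) (+ 1)) (sym (+-identityʳ _)))) g<)
      ... | no _ | yes g< = inj₁ (descent-at π q (fromℕ n-1) Fin.zero (+ 1)
        (inj₂ (cong ℕ.suc (toℕ-fromℕ n-1) , refl))
        (trans (cong (λ x → + x + + 1) (toℕ-fromℕ n-1)) (trans (+-comm (+ n-1) (+ 1)) (sym (trans (+-identityˡ (+ 1 * N)) (*-identityˡ N))))) g<)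
      ... | no ∄ | no wrap≮ = inj₂ λ i → trans (cong d (sym (inverseˡ π))) (trans (constant (π ⟨$⟩ʳ i)) g0≡0)
        where
        ascending : ∀ k → g (inject₁ k) ≤ g (Fin.suc k)
        ascending k = ≮⇒≥ (λ g< → ∄ (k , g<))
        above : ∀ p → g Fin.zero ≤ g p
        above = <-weakInduction (λ p → g Fin.zero ≤ g p) ≤-refl (λ k h → ≤-trans h (ascending k))
        below : ∀ p → g p ≤ g (fromℕ n-1)
        below = >-weakInduction (λ p → g p ≤ g (fromℕ n-1)) ≤-refl (λ k h → ≤-trans (ascending k) h)
        constant : ∀ p → g p ≡ g Fin.zero
        constant p = ≤-antisym (≤-trans (below p) (≮⇒≥ wrap≮)) (above p)
        -- The constant value summed over all positions is the sum of all displacements, which is 0.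
        N*g0≡0 : N * g Fin.zero ≡ 0ℤ
        N*g0≡0 = trans (sym (trans (sum-cong-≗ {n} constant) (∑-const {n} (g Fin.zero))))
          (trans (sym (∑-permute {n} d (flip π))) (∑d≡0 ∑q))
        g0≡0 : g Fin.zero ≡ 0ℤ
        g0≡0 = [ (λ ()) , id ]′ (i*j≡0⇒i≡0∨j≡0 N {g Fin.zero} N*g0≡0)

    Φ≥0 : ∀ π q → 0ℤ ≤ Lift.Φ π q
    Φ≥0 π q = ≤-trans (≤-reflexive (sym (sum-replicate-zero n)))
      (∑-mono-≤ {n} (λ a → ≤-trans (≤-reflexive (sym (sum-replicate-zero n))) (∑-mono-≤ {n} (λ b → +≤+ (ℕ.z≤n {∣ Lift.D π q a b ∣})))))

    -- `ℓ` is measured on the scale of `Φ`, which counts pairs twice; hence the factor 2.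
    SortableWithin : ℕ → Permutation′ n → Set
    SortableWithin ℓ π = Σ[ ts ∈ TranspositionList n ]
      (All CyclicallyAdjacent ts × 2 ℕ.* length ts ℕ.≤ ℓ × Sorts ts π)

    prepend : ∀ {ℓ π p p′} → CyclicallyAdjacent (p , p′) →
      SortableWithin ℓ (applyTransposition π (p , p′)) → SortableWithin (ℕ.suc (ℕ.suc ℓ)) π
    prepend {ℓ} {p = p} {p′} adjacent (ts , adjacents , len , sorts) =
      (p , p′) ∷ ts , adjacent ∷ adjacents ,
      subst (ℕ._≤ ℕ.suc (ℕ.suc ℓ)) (sym (ℕ.*-suc 2 (length ts))) (ℕ.s≤s (ℕ.s≤s len)) , sorts

    -- Recursion on `ℓ` in steps of two, the drop of `Φ` per swap. For `ℓ` below 2 a descent is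
    -- impossible, as `Φ` would become negative.
    sort : ∀ ℓ π q → ∑[ i < n ] q i ≡ 0ℤ → Lift.Φ π q ≤ + ℓ → SortableWithin ℓ π
    sort-from : ∀ ℓ π q → ∑[ i < n ] q i ≡ 0ℤ → Lift.Φ π q ≤ + ℓ →
      Descent π q ⊎ (∀ i → Lift.d π q i ≡ 0ℤ) → SortableWithin ℓ π

    sort ℓ π q ∑q Φ≤ℓ = sort-from ℓ π q ∑q Φ≤ℓ (descent-or-still π q ∑q)

    -- Displacement 0 makes `i` congruent to its position modulo n, hence equal to it.
    sort-from ℓ π q ∑q Φ≤ℓ (inj₂ d≡0) = [] , [] , ℕ.z≤n , λ i →
      sym (residues-distinct i (π ⟨$⟩ʳ i) (q i) (i-j≡0⇒i≡j (+ toℕ i) (Lift.P π q i) (d≡0 i)))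
    sort-from ℕ.zero π q ∑q Φ≤ℓ (inj₁ (i , j , w , _ , eq , d<)) =
      contradiction (≤-trans (2≤Φ (Φ≥0 π′ q′)) Φ≤ℓ) λ { (+≤+ ()) }
      where open Step π q i j w eq d<
    sort-from (ℕ.suc ℕ.zero) π q ∑q Φ≤ℓ (inj₁ (i , j , w , _ , eq , d<)) =
      contradiction (≤-trans (2≤Φ (Φ≥0 π′ q′)) Φ≤ℓ) λ { (+≤+ (ℕ.s≤s ())) }
      where open Step π q i j w eq d<
    sort-from (ℕ.suc (ℕ.suc ℓ)) π q ∑q Φ≤ℓ (inj₁ (i , j , w , adjacent , eq , d<)) =
      prepend {π = π} adjacent (sort ℓ π′ q′ (∑q′ ∑q) (Φ′≤ (+ ℓ) Φ≤ℓ))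
      where open Step π q i j w eq d<

-- From the count of crossings to n² / 4.

open import Data.Nat.Base using (_*_; _^_; _≤_)

theorem1 : (n : ℕ) (π : Permutation′ n) →
    Σ[ ts ∈ TranspositionList n ]
    (All CyclicallyAdjacent ts × 4 * length ts ≤ n ^ 2 × Sorts ts π)
-- The floors divide by n, so n = 0 is treated apart.
theorem1 ℕ.zero π = [] , [] , ℕ.z≤n , λ ()
theorem1 n@(ℕ.suc n-1) π = ts , adjacent , ℤ.drop‿+≤+ 4L≤n² , sorts
  where
  winding = Sorting.balanced-winding n-1 π
  q = proj₁ winding
  ∑q = proj₁ (proj₂ winding)
  θ = proj₁ (proj₂ (proj₂ winding))
  d≤θ = proj₁ (proj₂ (proj₂ (proj₂ winding)))
  θ≤d+N = proj₂ (proj₂ (proj₂ (proj₂ winding)))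

  open Sorting.Lift n-1 π q

  Φ≡∣Φ∣ : + ∣ Φ ∣ ≡ Φ
  Φ≡∣Φ∣ = ℤ.0≤i⇒+∣i∣≡i (Sorting.Φ≥0 n-1 π q)

  m = proj₁ (near-half n θ)
  selection = select-smallest d m (proj₁ (proj₂ (near-half n θ)))

  B : ℤ
  B = + m ℤ.* + m ℤ.+ (+ n ℤ.- + 2 ℤ.* + m) ℤ.* θ

  Φ≤2B : Φ ℤ.≤ + 2 ℤ.* B
  Φ≤2B = Φ-bound ∑q θ d≤θ θ≤d+N (proj₁ selection) (+ m) (proj₁ (proj₂ selection)) (proj₂ (proj₂ selection))

  sorting : Sorting.SortableWithin n-1 ∣ Φ ∣ π
  sorting = Sorting.sort n-1 ∣ Φ ∣ π q ∑q (ℤ.≤-reflexive (sym Φ≡∣Φ∣))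

  ts = proj₁ sorting
  adjacent = proj₁ (proj₂ sorting)
  2L≤Φ = proj₁ (proj₂ (proj₂ sorting))
  sorts = proj₂ (proj₂ (proj₂ sorting))

  open ℤ.≤-Reasoning

  4L≤n² : + (4 * length ts) ℤ.≤ + (n ^ 2)
  -- `B` bounds the number of crossings, so `Φ` is at most `2B`; a swap costs 2 of `Φ`, and
  -- `near-half` bounds `4B`.
  4L≤n² = begin
    + (4 * length ts)       ≡⟨ cong +_ (ℕ.*-assoc 2 2 (length ts)) ⟩
    + (2 * (2 * length ts)) ≤⟨ ℤ.+≤+ (ℕ.*-monoʳ-≤ 2 2L≤Φ) ⟩
    + (2 * ∣ Φ ∣)           ≡⟨ ℤ.pos-* 2 ∣ Φ ∣ ⟩
    + 2 ℤ.* + ∣ Φ ∣         ≡⟨ cong (ℤ._*_ (+ 2)) Φ≡∣Φ∣ ⟩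
    + 2 ℤ.* Φ               ≤⟨ ℤ.*-monoˡ-≤-nonNeg (+ 2) Φ≤2B ⟩
    + 2 ℤ.* (+ 2 ℤ.* B)     ≡⟨ ℤ.*-assoc (+ 2) (+ 2) B ⟨
    + 4 ℤ.* B               ≤⟨ proj₂ (proj₂ (near-half n θ)) ⟩
    + n ℤ.* + n             ≡⟨ ℤ.pos-* n n ⟨
    + (n * n)               ≡⟨ cong (λ k → + (n * k)) (ℕ.*-identityʳ n) ⟨
    + (n ^ 2)               ∎
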